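{- Let $\phi\colon \mathbb{F}_q[T]\to \mathrm{End}_{\mathbb{F}_q(T)}(\mathbb{G}_a)$ be a Drinfeld module of rank $2$ given by $$\phi_T(x)=Tx+gx^q+\Delta x^{q^2},$$ where $g,\Delta\in\mathbb{F}_q[T]$ (with $\Delta\neq 0$). Let $N$ be the least common multiple of the degrees of the irreducible divisors of $\Delta$. Suppose that $\phi_T(1)=T+g+\Delta$ is coprime to $T\Delta$ in $\mathbb{F}_q[T]$. Let $S$ be the finite set of places $\{v\in M_{\mathbb{F}_q(T)} : v\mid T\Delta\}\cup\{v_\infty\}$. If $x\in\mathbb{F}_q[T]$ is not a torsion point of $\phi$, then $$\max \mathcal{Z}(\phi,x)\le \left(6(q^{2N}-1)N|S|+4\right)+\frac12\log_q\left(2+2\deg g+2\deg\Delta\right).$$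
   Context: $q$ is a power of a prime $p$. $M_{\mathbb{F}_q(T)}$ is the set of places of $\mathbb{F}_q(T)$: the finite places, corresponding to monic irreducible polynomials $P\in\mathbb{F}_q[T]$, and the infinite place $v_\infty$; "$v\mid T\Delta$" means $v$ is a finite place whose irreducible polynomial divides $T\Delta$. A Drinfeld module $\phi$ of rank $2$ is the $\mathbb{F}_q$-algebra homomorphism determined by $\phi_T$ as given, acting on the additive group by $\mathbb{F}_q$-linear polynomials; $\phi_{T^n}$ is the $n$-fold composition of $\phi_T$ (with $\phi_{T^0}(x)=x$). A point $x$ is a torsion point of $\phi$ if $\phi_a(x)=0$ for some nonzero $a\in\mathbb{F}_q[T]$. For $n\ge 0$ write $\phi_{T^n}(x)=\mathfrak{A}_n\mathfrak{B}_n^{ -1}$ with $\mathfrak{A}_n,\mathfrak{B}_n\in\mathbb{F}_q[T]$ coprime. A primitive divisor of $\mathfrak{A}_n$ is a prime $\mathfrak{p}$ of $\mathbb{F}_q[T]$ with $\mathfrak{p}\mid\mathfrak{A}_n$ and $\mathfrak{p}\nmid\mathfrak{A}_i$ for all $0\le i<n$. The Zsigmondy set is $\mathcal{Z}(\phi,x)=\{n\ge1:\mathfrak{A}_n\text{ has no primitive divisor}\}$. $\log_q$ denotes logarithm to base $q$. -}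

module Defs where

open import Level using (0ℓ)
open import Data.Nat as ℕ using (ℕ; zero; suc; _∸_)
open import Data.List using (List; []; _∷_; _++_; length)
open import Data.List.Membership.Propositional using (_∈_)
open import Data.List.Relation.Unary.Unique.Propositional using (Unique)
open import Data.Product using (Σ; _×_; _,_)
open import Data.Sum using (_⊎_)
open import Relation.Nullary using (¬_; Dec; yes; no)
open import Relation.Binary.PropositionalEquality using (_≡_)
open import Algebra.Structures using (IsCommutativeRing)
open import Function using (_∘_)

record FiniteField : Set₁ where
  field
    F        : Set
    0#       : F
    1#       : F
    _+_      : F → F → F
    _*_      : F → F → F
    -_       : F → F
    isCommutativeRing : IsCommutativeRing _≡_ _+_ _*_ -_ 0# 1#
    0≢1      : ¬ (0# ≡ 1#)
    inv      : ∀ a → ¬ (a ≡ 0#) → Σ F λ b → a * b ≡ 1#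
    _≟_      : (a b : F) → Dec (a ≡ b)
    elements : List F
    complete : ∀ a → a ∈ elements
    unique   : Unique elements

  q : ℕ
  q = length elements

module Poly (𝔽 : FiniteField) where
  open FiniteField 𝔽

  -- Polynomials in F_q[T] as coefficient lists, constant term first.
  -- Trailing zero coefficients are allowed; equality is up to them (≈ₚ).
  Pol : Set
  Pol = List F

  strip : Pol → Pol
  strip [] = []
  strip (a ∷ p) with strip p
  ... | b ∷ r = a ∷ b ∷ r
  ... | [] with a ≟ 0#
  ...   | yes _ = []
  ...   | no  _ = a ∷ []

  _≈ₚ_ : Pol → Pol → Set
  p ≈ₚ r = strip p ≡ strip r

  IsZero : Pol → Set
  IsZero p = strip p ≡ []

  -- degree, with the convention deg 0 = 0
  deg : Pol → ℕ
  deg p = length (strip p) ∸ 1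

  constP : F → Pol
  constP c = c ∷ []

  oneP : Pol
  oneP = 1# ∷ []

  Tₚ : Pol
  Tₚ = 0# ∷ 1# ∷ []

  _+ₚ_ : Pol → Pol → Pol
  [] +ₚ r = r
  (a ∷ p) +ₚ [] = a ∷ p
  (a ∷ p) +ₚ (b ∷ r) = (a + b) ∷ (p +ₚ r)

  scale : F → Pol → Pol
  scale c [] = []
  scale c (a ∷ p) = (c * a) ∷ scale c p

  _*ₚ_ : Pol → Pol → Pol
  [] *ₚ r = []
  (a ∷ p) *ₚ r = scale a r +ₚ (0# ∷ (p *ₚ r))

  _^ₚ_ : Pol → ℕ → Pol
  p ^ₚ zero = oneP
  p ^ₚ suc n = p *ₚ (p ^ₚ n)

  _∣ₚ_ : Pol → Pol → Set
  a ∣ₚ b = Σ Pol λ c → (c *ₚ a) ≈ₚ b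

  IsUnit : Pol → Set
  IsUnit u = Σ Pol λ v → (u *ₚ v) ≈ₚ oneP

  Coprime : Pol → Pol → Set
  Coprime a b = ∀ d → d ∣ₚ a → d ∣ₚ b → IsUnit d

  Irreducible : Pol → Set
  Irreducible p = ¬ IsZero p × ¬ IsUnit p
                × (∀ a b → (a *ₚ b) ≈ₚ p → IsUnit a ⊎ IsUnit b)

  -- monic: leading (last) coefficient is 1 (so the list is normalized)
  Monic : Pol → Set
  Monic p = Σ Pol λ r → p ≡ r ++ (1# ∷ [])

  module Drinfeld (g Δ : Pol) where

    φT : Pol → Pol
    φT y = (Tₚ *ₚ y) +ₚ ((g *ₚ (y ^ₚ q)) +ₚ (Δ *ₚ (y ^ₚ (q ℕ.* q))))

    φTⁿ : ℕ → Pol → Pol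
    φTⁿ zero y = y
    φTⁿ (suc n) y = φT (φTⁿ n y)

    φ : Pol → Pol → Pol
    φ [] y = []
    φ (c ∷ a) y = scale c y +ₚ φ a (φT y)

    IsTorsion : Pol → Set
    IsTorsion x = Σ Pol λ a → ¬ IsZero a × IsZero (φ a x)

    -- For x ∈ F_q[T], φ_{T^n}(x) ∈ F_q[T], so 𝔄_n = φ_{T^n}(x) (𝔅_n = 1).
    𝔄 : Pol → ℕ → Pol
    𝔄 x n = φTⁿ n x

    HasPrimitiveDivisor : Pol → ℕ → Set
    HasPrimitiveDivisor x n =
      Σ Pol λ 𝔭 → Irreducible 𝔭 × 𝔭 ∣ₚ 𝔄 x n
                × (∀ i → i ℕ.< n → ¬ (𝔭 ∣ₚ 𝔄 x i))

    InZsigmondy : Pol → ℕ → Set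
    InZsigmondy x n = 1 ℕ.≤ n × ¬ HasPrimitiveDivisor x n

{-# OPTIONS --safe #-}
module Submission where

-- Write 𝔄ₙ₊₁ = Cₙ 𝔄ₙ with Cₙ = T + 𝔄ₙ^(q−1) (g + Δ 𝔄ₙ^(q²−q)). A prime dividing both Cₙ and 𝔄ₙ
-- divides T, and a prime dividing some 𝔄ᵢ divides all later ones; so 𝔄ₙ₊₁ has a primitive divisor
-- as soon as Cₙ has a prime factor other than T.
-- Degrees: if Cₙ were constant, x would be torsion; hence deg 𝔄ₙ ≥ n, and for n ≥ 2 comparing the
-- degrees of g and Δ 𝔄ₙ^(q²−q) gives deg Cₙ ≥ 2.
-- T-adically: T² ∤ Cₙ for n ≥ 1. If T ∤ 𝔄ₙ, then a^(q−1) = 1 in 𝔽_q gives Cₙ ≡ g + Δ ≡ φ_T(1) mod T,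
-- a unit by hypothesis. If T ∣ 𝔄ₙ, the same remark gives T ∣ 𝔄ₙ₋₁ and T ∣ Cₙ₋₁, so T² ∣ 𝔄ₙ and
-- Cₙ ≡ T mod T².
-- So the Zsigmondy set is contained in {1, 2}, far below the stated bound.

open import Defs
open import Level using (0ℓ)
open import Algebra.Bundles using (CommutativeRing)
import Algebra.Properties.CommutativeSemigroup as CommutativeSemigroupProperties
import Algebra.Properties.Semiring.Exp as Exp
open import Data.Empty using (⊥-elim)
open import Data.Nat using (ℕ; zero; suc; _+_; _*_; _∸_; _^_; _≤_; _<_; z≤n; s≤s; >-nonZero)
import Data.Nat.Properties as ℕₚ
open import Data.Nat.Divisibility using (_∣_)
open import Data.Nat.Induction using (<-rec)
open import Data.List using (List; []; _∷_; _++_; length; foldr; map; filter; replicate)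
open import Data.List.Membership.Propositional using (_∈_)
open import Data.List.Membership.Propositional.Properties using (∈-filter⁺; ∈-filter⁻; ∈-map⁺; ∈-map⁻)
open import Data.List.Membership.Propositional.Properties.WithK using (unique∧set⇒bag)
open import Data.List.Relation.Binary.BagAndSetEquality using (∼bag⇒↭)
open import Data.List.Relation.Binary.Permutation.Propositional using (_↭_; ↭⇒↭ₛ)
open import Data.List.Relation.Binary.Permutation.Propositional.Properties using (↭-length)
import Data.List.Relation.Binary.Permutation.Setoid.Properties as PermutationProperties
open import Data.List.Relation.Unary.All as All using (All; []; _∷_)
open import Data.List.Relation.Unary.AllPairs using (_∷_)
open import Data.List.Relation.Unary.Any using (here; there)
open import Data.List.Relation.Unary.Unique.Propositional using (Unique)
open import Data.List.Relation.Unary.Unique.Propositional.Properties using (map⁺; filter⁺)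
open import Data.Product using (Σ; ∃; _×_; _,_; proj₂)
open import Data.Sum using (_⊎_; inj₁; inj₂)
open import Function using (mk⇔)
open import Relation.Nullary using (¬_; Dec; yes; no; ¬?; contradiction)
open import Relation.Binary.Bundles using (Setoid)
open import Relation.Binary.PropositionalEquality using (_≡_; _≢_; refl; sym; trans; cong; cong₂; subst; setoid; module ≡-Reasoning)
import Relation.Binary.Reasoning.Setoid as SetoidReasoning

module FiniteFieldProperties (𝔽 : FiniteField) where
  open FiniteField 𝔽 using (F; 0#; 1#; isCommutativeRing; 0≢1; inv; _≟_; elements; complete; unique; q)

  commutativeRing : CommutativeRing 0ℓ 0ℓ
  commutativeRing = record { isCommutativeRing = isCommutativeRing }

  module R = CommutativeRing commutativeRing
  open Exp R.semiring public using () renaming (_^_ to _^ᶠ_; ^-homo-* to ^ᶠ-homo-*)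

  *-≢0 : ∀ {a b} → a ≢ 0# → b ≢ 0# → a R.* b ≢ 0#
  *-≢0 {a} {b} a≢0 b≢0 ab≡0 with inv a a≢0
  ... | c , ac≡1 = b≢0 (begin
    b                  ≡⟨ sym (R.*-identityˡ b) ⟩
    1# R.* b           ≡⟨ cong (R._* b) (trans (sym ac≡1) (R.*-comm a c)) ⟩
    (c R.* a) R.* b    ≡⟨ R.*-assoc c a b ⟩
    c R.* (a R.* b)    ≡⟨ cong (c R.*_) ab≡0 ⟩
    c R.* 0#           ≡⟨ R.zeroʳ c ⟩
    0#                 ∎)
    where open ≡-Reasoning

  *-cancelˡ : ∀ {a b c} → a ≢ 0# → a R.* b ≡ a R.* c → b ≡ c
  *-cancelˡ {a} {b} {c} a≢0 eq with inv a a≢0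
  ... | d , ad≡1 = trans (sym (undo b)) (trans (cong (d R.*_) eq) (undo c))
    where
    undo : ∀ e → d R.* (a R.* e) ≡ e
    undo e = trans (sym (R.*-assoc d a e))
      (trans (cong (R._* e) (trans (R.*-comm d a) ad≡1)) (R.*-identityˡ e))

  ≡0⇒*≡0ˡ : ∀ {a b} → a ≡ 0# → a R.* b ≡ 0#
  ≡0⇒*≡0ˡ refl = R.zeroˡ _

  ≡0⇒*≡0ʳ : ∀ {a b} → b ≡ 0# → a R.* b ≡ 0#
  ≡0⇒*≡0ʳ refl = R.zeroʳ _

  2≤q : 2 ≤ q
  2≤q with elements | complete 0# | complete 1#
  ... | _ ∷ []    | here 0≡a | here 1≡a = contradiction (trans 0≡a (sym 1≡a)) 0≢1
  ... | _ ∷ _ ∷ _ | _        | _        = s≤s (s≤s z≤n)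

  unique-set⇒↭ : ∀ {xs ys : List F} → Unique xs → Unique ys →
                 (∀ {a} → a ∈ xs → a ∈ ys) → (∀ {a} → a ∈ ys → a ∈ xs) → xs ↭ ys
  unique-set⇒↭ u v f g = ∼bag⇒↭ (unique∧set⇒bag u v (mk⇔ f g))

  nonzero? : (a : F) → Dec (a ≢ 0#)
  nonzero? a = ¬? (a ≟ 0#)

  units : List F
  units = filter nonzero? elements

  units-unique : Unique units
  units-unique = filter⁺ nonzero? unique

  ∈-units : ∀ {a} → a ≢ 0# → a ∈ units
  ∈-units {a} a≢0 = ∈-filter⁺ nonzero? (complete a) a≢0

  units-≢0 : ∀ {a} → a ∈ units → a ≢ 0#
  units-≢0 a∈ = proj₂ (∈-filter⁻ nonzero? {xs = elements} a∈)

  q≡1+∣units∣ : q ≡ suc (length units)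
  q≡1+∣units∣ = ↭-length (unique-set⇒↭ unique
    (All.tabulate (λ a∈ 0≡a → units-≢0 a∈ (sym 0≡a)) ∷ units-unique)
    split (λ _ → complete _))
    where
    split : ∀ {a} → a ∈ elements → a ∈ 0# ∷ units
    split {a} _ with a ≟ 0#
    ... | yes a≡0 = here a≡0
    ... | no  a≢0 = there (∈-units a≢0)

  ∏ : List F → F
  ∏ = foldr R._*_ 1#

  ∏-↭ : ∀ {xs ys} → xs ↭ ys → ∏ xs ≡ ∏ ys
  ∏-↭ xs↭ys = PermutationProperties.foldr-commMonoid (setoid F) R.*-isCommutativeMonoid (↭⇒↭ₛ xs↭ys)

  ∏-≢0 : ∀ {xs} → All (_≢ 0#) xs → ∏ xs ≢ 0#
  ∏-≢0 []       1≡0 = 0≢1 (sym 1≡0)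
  ∏-≢0 (p ∷ ps) = *-≢0 p (∏-≢0 ps)

  ∏-map-* : ∀ a xs → ∏ (map (a R.*_) xs) ≡ (a ^ᶠ length xs) R.* ∏ xs
  ∏-map-* a []       = sym (R.*-identityˡ 1#)
  ∏-map-* a (b ∷ xs) = trans (cong ((a R.* b) R.*_) (∏-map-* a xs)) (interchange a b (a ^ᶠ length xs) (∏ xs))
    where open CommutativeSemigroupProperties R.*-commutativeSemigroup using (interchange)

  fermat : ∀ {a} → a ≢ 0# → a ^ᶠ length units ≡ 1#
  fermat {a} a≢0 = *-cancelˡ (∏-≢0 (All.tabulate units-≢0)) (begin
    ∏ units R.* (a ^ᶠ length units)   ≡⟨ R.*-comm _ _ ⟩
    (a ^ᶠ length units) R.* ∏ units   ≡⟨ sym (∏-map-* a units) ⟩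
    ∏ (map (a R.*_) units)            ≡⟨ ∏-↭ aU↭U ⟩
    ∏ units                           ≡⟨ sym (R.*-identityʳ _) ⟩
    ∏ units R.* 1#                    ∎)
    where
    open ≡-Reasoning
    to : ∀ {b} → b ∈ map (a R.*_) units → b ∈ units
    to b∈ with ∈-map⁻ (a R.*_) b∈
    ... | _ , c∈ , refl = ∈-units (*-≢0 a≢0 (units-≢0 c∈))
    from : ∀ {b} → b ∈ units → b ∈ map (a R.*_) units
    from {b} b∈ with inv a a≢0
    ... | c , ac≡1 = subst (_∈ map (a R.*_) units) a*cb≡b (∈-map⁺ (a R.*_) (∈-units cb≢0))
      where
      a*cb≡b : a R.* (c R.* b) ≡ b
      a*cb≡b = trans (sym (R.*-assoc a c b)) (trans (cong (R._* b) ac≡1) (R.*-identityˡ b))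
      cb≢0 : c R.* b ≢ 0#
      cb≢0 cb≡0 = units-≢0 b∈ (trans (sym a*cb≡b) (trans (cong (a R.*_) cb≡0) (R.zeroʳ a)))
    aU↭U : map (a R.*_) units ↭ units
    aU↭U = unique-set⇒↭ (map⁺ (*-cancelˡ a≢0) units-unique) units-unique to from

module PolynomialProperties (𝔽 : FiniteField) where
  open FiniteField 𝔽 using (F; 0#; 1#; 0≢1; inv; _≟_)
  open Poly 𝔽
  open FiniteFieldProperties 𝔽
  open CommutativeSemigroupProperties R.+-commutativeSemigroup using (interchange; x∙yz≈y∙xz)
  open ≡-Reasoning

  coeff : Pol → ℕ → F
  coeff []      _       = 0#
  coeff (a ∷ _) zero    = a
  coeff (_ ∷ p) (suc k) = coeff p k

  infix 4 _≋_
  record _≋_ (p r : Pol) : Set where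
    constructor coeffwise
    field at : ∀ k → coeff p k ≡ coeff r k
  open _≋_ public

  ≋-setoid : Setoid 0ℓ 0ℓ
  ≋-setoid = record
    { Carrier = Pol ; _≈_ = _≋_
    ; isEquivalence = record
      { refl  = coeffwise λ _ → refl
      ; sym   = λ e → coeffwise λ k → sym (at e k)
      ; trans = λ e f → coeffwise λ k → trans (at e k) (at f k) } }

  open Setoid ≋-setoid public using () renaming (refl to ≋-refl; sym to ≋-sym; trans to ≋-trans)
  module ≋-Reasoning = SetoidReasoning ≋-setoid

  ∷-cong : ∀ {a b p r} → a ≡ b → p ≋ r → a ∷ p ≋ b ∷ r
  ∷-cong a≡b p≋r = coeffwise λ where
    zero    → a≡b
    (suc k) → at p≋r k

  0∷[]≋[] : 0# ∷ [] ≋ []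
  0∷[]≋[] = coeffwise λ where
    zero    → refl
    (suc _) → refl

  strip-≋ : ∀ p → strip p ≋ p
  strip-≋ []      = ≋-refl
  strip-≋ (a ∷ p) with strip p | strip-≋ p
  ... | b ∷ r | e = ∷-cong refl e
  ... | []    | e with a ≟ 0#
  ...   | yes refl = ≋-trans (≋-sym 0∷[]≋[]) (∷-cong refl e)
  ...   | no  _    = ∷-cong refl e

  ≈ₚ⇒≋ : ∀ p r → p ≈ₚ r → p ≋ r
  ≈ₚ⇒≋ p r e = ≋-trans (≋-sym (strip-≋ p)) (subst (_≋ r) (sym e) (strip-≋ r))

  strip-∷-cong : ∀ {a b} p r → a ≡ b → strip p ≡ strip r → strip (a ∷ p) ≡ strip (b ∷ r)
  strip-∷-cong p r refl e with strip p | strip r | e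
  ... | s | .s | refl = refl

  strip-0∷[] : strip (0# ∷ []) ≡ []
  strip-0∷[] with 0# ≟ 0#
  ... | yes _   = refl
  ... | no 0≢0 = contradiction refl 0≢0

  ≋⇒≈ₚ : ∀ {p r} → p ≋ r → p ≈ₚ r
  ≋⇒≈ₚ {[]}    {[]}    e = refl
  ≋⇒≈ₚ {[]}    {b ∷ r} e = trans (sym strip-0∷[])
    (strip-∷-cong [] r (at e 0) (≋⇒≈ₚ {[]} {r} (coeffwise λ k → at e (suc k))))
  ≋⇒≈ₚ {a ∷ p} {[]}    e = trans
    (strip-∷-cong p [] (at e 0) (≋⇒≈ₚ {p} {[]} (coeffwise λ k → at e (suc k)))) strip-0∷[]
  ≋⇒≈ₚ {a ∷ p} {b ∷ r} e = strip-∷-cong p r (at e 0) (≋⇒≈ₚ {p} {r} (coeffwise λ k → at e (suc k)))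

  coeff-+ : ∀ p r k → coeff (p +ₚ r) k ≡ coeff p k R.+ coeff r k
  coeff-+ []      r       k       = sym (R.+-identityˡ _)
  coeff-+ (a ∷ p) []      k       = sym (R.+-identityʳ _)
  coeff-+ (a ∷ p) (b ∷ r) zero    = refl
  coeff-+ (a ∷ p) (b ∷ r) (suc k) = coeff-+ p r k

  coeff-scale : ∀ c p k → coeff (scale c p) k ≡ c R.* coeff p k
  coeff-scale c []      k       = sym (R.zeroʳ c)
  coeff-scale c (a ∷ p) zero    = refl
  coeff-scale c (a ∷ p) (suc k) = coeff-scale c p k

  coeff-∷* : ∀ a p r k → coeff ((a ∷ p) *ₚ r) k ≡ a R.* coeff r k R.+ coeff (0# ∷ (p *ₚ r)) k
  coeff-∷* a p r k = trans (coeff-+ (scale a r) _ k) (cong (R._+ _) (coeff-scale a r k))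

  +ₚ-cong : ∀ {p p′ r r′} → p ≋ p′ → r ≋ r′ → p +ₚ r ≋ p′ +ₚ r′
  +ₚ-cong {p} {p′} {r} {r′} e f = coeffwise λ k →
    trans (coeff-+ p r k) (trans (cong₂ R._+_ (at e k) (at f k)) (sym (coeff-+ p′ r′ k)))

  +ₚ-congˡ : ∀ p {r s} → r ≋ s → p +ₚ r ≋ p +ₚ s
  +ₚ-congˡ p = +ₚ-cong {p} ≋-refl

  +ₚ-comm : ∀ p r → p +ₚ r ≋ r +ₚ p
  +ₚ-comm p r = coeffwise λ k →
    trans (coeff-+ p r k) (trans (R.+-comm _ _) (sym (coeff-+ r p k)))

  scale-0 : ∀ p → scale 0# p ≋ []
  scale-0 p = coeffwise λ k → trans (coeff-scale 0# p k) (R.zeroˡ _)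

  scale-1 : ∀ p → scale 1# p ≋ p
  scale-1 p = coeffwise λ k → trans (coeff-scale 1# p k) (R.*-identityˡ _)

  *ₚ-zeroʳ : ∀ p → p *ₚ [] ≋ []
  *ₚ-zeroʳ []      = ≋-refl
  *ₚ-zeroʳ (a ∷ p) = ≋-trans (∷-cong refl (*ₚ-zeroʳ p)) 0∷[]≋[]

  *ₚ-∷ : ∀ p b r → p *ₚ (b ∷ r) ≋ scale b p +ₚ (0# ∷ (p *ₚ r))
  *ₚ-∷ []      b r = ≋-sym 0∷[]≋[]
  *ₚ-∷ (a ∷ p) b r = coeffwise λ where
    zero    → cong (R._+ 0#) (R.*-comm a b)
    (suc k) → begin
      coeff (scale a r +ₚ (p *ₚ (b ∷ r))) k
        ≡⟨ coeff-+ (scale a r) _ k ⟩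
      coeff (scale a r) k R.+ coeff (p *ₚ (b ∷ r)) k
        ≡⟨ cong (coeff (scale a r) k R.+_) (trans (at (*ₚ-∷ p b r) k) (coeff-+ (scale b p) _ k)) ⟩
      coeff (scale a r) k R.+ (coeff (scale b p) k R.+ coeff (0# ∷ (p *ₚ r)) k)
        ≡⟨ x∙yz≈y∙xz _ _ _ ⟩
      coeff (scale b p) k R.+ (coeff (scale a r) k R.+ coeff (0# ∷ (p *ₚ r)) k)
        ≡⟨ cong (coeff (scale b p) k R.+_) (sym (coeff-+ (scale a r) _ k)) ⟩
      coeff (scale b p) k R.+ coeff ((a ∷ p) *ₚ r) k
        ≡⟨ sym (coeff-+ (scale b p) _ k) ⟩
      coeff (scale b p +ₚ ((a ∷ p) *ₚ r)) k ∎

  *ₚ-comm : ∀ p r → p *ₚ r ≋ r *ₚ p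
  *ₚ-comm []      r = ≋-sym (*ₚ-zeroʳ r)
  *ₚ-comm (a ∷ p) r = ≋-trans (+ₚ-cong ≋-refl (∷-cong refl (*ₚ-comm p r))) (≋-sym (*ₚ-∷ r a p))

  *ₚ-congˡ : ∀ p {r s} → r ≋ s → p *ₚ r ≋ p *ₚ s
  *ₚ-congˡ []      e = ≋-refl
  *ₚ-congˡ (a ∷ p) {r} {s} e = +ₚ-cong
    (coeffwise λ k → trans (coeff-scale a r k) (trans (cong (a R.*_) (at e k)) (sym (coeff-scale a s k))))
    (∷-cong refl (*ₚ-congˡ p e))

  *ₚ-congʳ : ∀ p {r s} → r ≋ s → r *ₚ p ≋ s *ₚ p
  *ₚ-congʳ p {r} {s} e = ≋-trans (*ₚ-comm r p) (≋-trans (*ₚ-congˡ p e) (*ₚ-comm p s))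

  *ₚ-distribˡ : ∀ p r s → p *ₚ (r +ₚ s) ≋ (p *ₚ r) +ₚ (p *ₚ s)
  *ₚ-distribˡ []      r s = ≋-refl
  *ₚ-distribˡ (a ∷ p) r s = coeffwise λ k → begin
    coeff ((a ∷ p) *ₚ (r +ₚ s)) k
      ≡⟨ coeff-∷* a p (r +ₚ s) k ⟩
    a R.* coeff (r +ₚ s) k R.+ coeff (0# ∷ (p *ₚ (r +ₚ s))) k
      ≡⟨ cong₂ R._+_ (trans (cong (a R.*_) (coeff-+ r s k)) (R.distribˡ a _ _)) (shifted k) ⟩
    (a R.* coeff r k R.+ a R.* coeff s k) R.+ (coeff (0# ∷ (p *ₚ r)) k R.+ coeff (0# ∷ (p *ₚ s)) k)
      ≡⟨ interchange _ _ _ _ ⟩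
    (a R.* coeff r k R.+ coeff (0# ∷ (p *ₚ r)) k) R.+ (a R.* coeff s k R.+ coeff (0# ∷ (p *ₚ s)) k)
      ≡⟨ sym (cong₂ R._+_ (coeff-∷* a p r k) (coeff-∷* a p s k)) ⟩
    coeff ((a ∷ p) *ₚ r) k R.+ coeff ((a ∷ p) *ₚ s) k
      ≡⟨ sym (coeff-+ ((a ∷ p) *ₚ r) _ k) ⟩
    coeff (((a ∷ p) *ₚ r) +ₚ ((a ∷ p) *ₚ s)) k ∎
    where
    shifted : ∀ k → coeff (0# ∷ (p *ₚ (r +ₚ s))) k ≡ coeff (0# ∷ (p *ₚ r)) k R.+ coeff (0# ∷ (p *ₚ s)) k
    shifted zero    = sym (R.+-identityˡ 0#)
    shifted (suc k) = trans (at (*ₚ-distribˡ p r s) k) (coeff-+ (p *ₚ r) _ k)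

  *ₚ-distribʳ : ∀ p r s → (r +ₚ s) *ₚ p ≋ (r *ₚ p) +ₚ (s *ₚ p)
  *ₚ-distribʳ p r s = ≋-trans (*ₚ-comm (r +ₚ s) p)
    (≋-trans (*ₚ-distribˡ p r s) (+ₚ-cong (*ₚ-comm p r) (*ₚ-comm p s)))

  scale-*ₚ : ∀ a r s → scale a r *ₚ s ≋ scale a (r *ₚ s)
  scale-*ₚ a []      s = ≋-refl
  scale-*ₚ a (b ∷ r) s = coeffwise λ k → begin
    coeff ((a R.* b ∷ scale a r) *ₚ s) k
      ≡⟨ coeff-∷* (a R.* b) (scale a r) s k ⟩
    (a R.* b) R.* coeff s k R.+ coeff (0# ∷ (scale a r *ₚ s)) k
      ≡⟨ cong₂ R._+_ (R.*-assoc a b _) (shifted k) ⟩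
    a R.* (b R.* coeff s k) R.+ a R.* coeff (0# ∷ (r *ₚ s)) k
      ≡⟨ sym (R.distribˡ a _ _) ⟩
    a R.* (b R.* coeff s k R.+ coeff (0# ∷ (r *ₚ s)) k)
      ≡⟨ cong (a R.*_) (sym (coeff-∷* b r s k)) ⟩
    a R.* coeff ((b ∷ r) *ₚ s) k
      ≡⟨ sym (coeff-scale a ((b ∷ r) *ₚ s) k) ⟩
    coeff (scale a ((b ∷ r) *ₚ s)) k ∎
    where
    shifted : ∀ k → coeff (0# ∷ (scale a r *ₚ s)) k ≡ a R.* coeff (0# ∷ (r *ₚ s)) k
    shifted zero    = sym (R.zeroʳ a)
    shifted (suc k) = trans (at (scale-*ₚ a r s) k) (coeff-scale a (r *ₚ s) k)

  0∷-*ₚ : ∀ p r → (0# ∷ p) *ₚ r ≋ 0# ∷ (p *ₚ r)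
  0∷-*ₚ p r = +ₚ-cong {r = 0# ∷ (p *ₚ r)} (scale-0 r) ≋-refl

  *ₚ-assoc : ∀ p r s → (p *ₚ r) *ₚ s ≋ p *ₚ (r *ₚ s)
  *ₚ-assoc []      r s = ≋-refl
  *ₚ-assoc (a ∷ p) r s = ≋-trans (*ₚ-distribʳ s (scale a r) (0# ∷ (p *ₚ r)))
    (+ₚ-cong (scale-*ₚ a r s) (≋-trans (0∷-*ₚ (p *ₚ r) s) (∷-cong refl (*ₚ-assoc p r s))))

  *ₚ-identityˡ : ∀ p → oneP *ₚ p ≋ p
  *ₚ-identityˡ p = ≋-trans (+ₚ-comm (scale 1# p) _) (≋-trans (+ₚ-cong 0∷[]≋[] (scale-1 p)) ≋-refl)

  *ₚ-const : ∀ {c p} r → p ≋ c ∷ [] → p *ₚ r ≋ scale c r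
  *ₚ-const {c} r e = ≋-trans (*ₚ-congʳ r e) (≋-trans (+ₚ-comm (scale c r) _) (+ₚ-cong 0∷[]≋[] ≋-refl))

  ^ₚ-homo-* : ∀ p m n → p ^ₚ (m + n) ≋ (p ^ₚ m) *ₚ (p ^ₚ n)
  ^ₚ-homo-* p zero    n = ≋-sym (*ₚ-identityˡ _)
  ^ₚ-homo-* p (suc m) n = ≋-trans (*ₚ-congˡ p (^ₚ-homo-* p m n)) (≋-sym (*ₚ-assoc p _ _))

  coeff₀-* : ∀ p r → coeff (p *ₚ r) 0 ≡ coeff p 0 R.* coeff r 0
  coeff₀-* []      r = sym (R.zeroˡ _)
  coeff₀-* (a ∷ p) r = trans (coeff-∷* a p r 0) (R.+-identityʳ _)

  coeff₁-* : ∀ p r → coeff (p *ₚ r) 1 ≡ coeff p 0 R.* coeff r 1 R.+ coeff p 1 R.* coeff r 0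
  coeff₁-* []      r = sym (trans (cong₂ R._+_ (R.zeroˡ _) (R.zeroˡ _)) (R.+-identityˡ 0#))
  coeff₁-* (a ∷ p) r = trans (coeff-∷* a p r 1) (cong (a R.* coeff r 1 R.+_) (coeff₀-* p r))

  coeff₀-^ : ∀ p n → coeff (p ^ₚ n) 0 ≡ coeff p 0 ^ᶠ n
  coeff₀-^ p zero    = refl
  coeff₀-^ p (suc n) = trans (coeff₀-* p (p ^ₚ n)) (cong (coeff p 0 R.*_) (coeff₀-^ p n))

  *ₚ-T : ∀ p → p *ₚ Tₚ ≋ 0# ∷ p
  *ₚ-T p = ≋-trans (*ₚ-comm p Tₚ) (≋-trans (0∷-*ₚ oneP p) (∷-cong refl (*ₚ-identityˡ p)))

  Bounded : Pol → ℕ → Set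
  Bounded p d = ∀ k → d < k → coeff p k ≡ 0#

  record HasDegree (p : Pol) (d : ℕ) : Set where
    constructor hasDegree
    field
      leading : coeff p d ≢ 0#
      bounded : Bounded p d
  open HasDegree public

  Bounded-0⇒const : ∀ {p} → Bounded p 0 → p ≋ coeff p 0 ∷ []
  Bounded-0⇒const b = coeffwise λ where
    zero    → refl
    (suc k) → b (suc k) (s≤s z≤n)

  degree-cong : ∀ {p r d} → p ≋ r → HasDegree p d → HasDegree r d
  degree-cong e (hasDegree l b) = hasDegree
    (λ z → l (trans (at e _) z)) (λ k d<k → trans (sym (at e k)) (b k d<k))

  degree-≤ : ∀ {p d e} → HasDegree p d → Bounded p e → d ≤ e
  degree-≤ hd b = ℕₚ.≮⇒≥ λ e<d → leading hd (b _ e<d)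

  degree-unique : ∀ {p d e} → HasDegree p d → HasDegree p e → d ≡ e
  degree-unique hd he = ℕₚ.≤-antisym (degree-≤ hd (bounded he)) (degree-≤ he (bounded hd))

  degree-≢[] : ∀ {p d} → HasDegree p d → ¬ p ≋ []
  degree-≢[] hd e = leading hd (at e _)

  degree? : ∀ p → p ≋ [] ⊎ ∃ (HasDegree p)
  degree? []      = inj₁ ≋-refl
  degree? (a ∷ p) with degree? p
  ... | inj₂ (d , hasDegree l b) = inj₂ (suc d , hasDegree l λ { (suc k) (s≤s d<k) → b k d<k })
  ... | inj₁ e with a ≟ 0#
  ...   | yes a≡0 = inj₁ (≋-trans (∷-cong a≡0 e) 0∷[]≋[])
  ...   | no  a≢0 = inj₂ (0 , hasDegree a≢0 λ { (suc k) _ → at e k })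

  coeff-*-top : ∀ p r d e → Bounded p d → Bounded r e →
                coeff (p *ₚ r) (d + e) ≡ coeff p d R.* coeff r e × Bounded (p *ₚ r) (d + e)
  coeff-*-top []      r d       e bp br = sym (R.zeroˡ _) , λ _ _ → refl
  coeff-*-top (a ∷ p) r zero    e bp br =
    trans (at a∷p*r e) (coeff-scale a r e) ,
    λ k e<k → trans (at a∷p*r k) (trans (coeff-scale a r k) (trans (cong (a R.*_) (br k e<k)) (R.zeroʳ a)))
    where
    a∷p*r : (a ∷ p) *ₚ r ≋ scale a r
    a∷p*r = *ₚ-const r (Bounded-0⇒const bp)
  coeff-*-top (a ∷ p) r (suc d) e bp br with coeff-*-top p r d e (λ k d<k → bp (suc k) (s≤s d<k)) br
  ... | top , above =
    trans (step (d + e) (ℕₚ.m≤n+m e d)) top ,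
    λ { (suc k) (s≤s d+e<k) → trans (step k (ℕₚ.≤-trans (ℕₚ.m≤n+m e d) (ℕₚ.<⇒≤ d+e<k))) (above k d+e<k) }
    where
    step : ∀ k → e ≤ k → coeff ((a ∷ p) *ₚ r) (suc k) ≡ coeff (p *ₚ r) k
    step k e≤k = begin
      coeff ((a ∷ p) *ₚ r) (suc k)                 ≡⟨ coeff-∷* a p r (suc k) ⟩
      a R.* coeff r (suc k) R.+ coeff (p *ₚ r) k   ≡⟨ cong (λ c → a R.* c R.+ coeff (p *ₚ r) k) (br (suc k) (s≤s e≤k)) ⟩
      a R.* 0# R.+ coeff (p *ₚ r) k                ≡⟨ cong (R._+ coeff (p *ₚ r) k) (R.zeroʳ a) ⟩
      0# R.+ coeff (p *ₚ r) k                      ≡⟨ R.+-identityˡ _ ⟩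
      coeff (p *ₚ r) k                             ∎

  degree-* : ∀ {p r d e} → HasDegree p d → HasDegree r e → HasDegree (p *ₚ r) (d + e)
  degree-* {p} {r} {d} {e} (hasDegree lp bp) (hasDegree lr br) with coeff-*-top p r d e bp br
  ... | top , above = hasDegree (λ z → *-≢0 lp lr (trans (sym top) z)) above

  degree-1 : HasDegree oneP 0
  degree-1 = hasDegree (λ 1≡0 → 0≢1 (sym 1≡0)) λ { (suc k) _ → refl }

  degree-T : HasDegree Tₚ 1
  degree-T = hasDegree (λ 1≡0 → 0≢1 (sym 1≡0)) λ { (suc (suc k)) _ → refl ; (suc zero) (s≤s ()) }

  degree-^ : ∀ {p d} n → HasDegree p d → HasDegree (p ^ₚ n) (n * d)
  degree-^ zero    hd = degree-1
  degree-^ (suc n) hd = degree-* hd (degree-^ n hd)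

  degree-+ʳ : ∀ {p r d e} → Bounded p d → HasDegree r e → d < e → HasDegree (p +ₚ r) e
  degree-+ʳ {p} {r} {d} {e} bp hr d<e = hasDegree
    (λ z → leading hr (trans (sym (below e d<e)) z))
    (λ k e<k → trans (below k (ℕₚ.<-trans d<e e<k)) (bounded hr k e<k))
    where
    below : ∀ k → d < k → coeff (p +ₚ r) k ≡ coeff r k
    below k d<k = trans (coeff-+ p r k) (trans (cong (R._+ _) (bp k d<k)) (R.+-identityˡ _))

  degree-+ˡ : ∀ {p r d e} → HasDegree p e → Bounded r d → d < e → HasDegree (p +ₚ r) e
  degree-+ˡ {p} {r} hp br d<e = degree-cong (+ₚ-comm r p) (degree-+ʳ br hp d<e)

  degree-cancelling : ∀ {p r d} → p +ₚ r ≋ [] → HasDegree r d → HasDegree p d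
  degree-cancelling {p} {r} {d} e hr = hasDegree
    (λ z → leading hr (trans (sym (R.+-identityˡ _)) (trans (cong (R._+ _) (sym z)) (sum d))))
    (λ k d<k → trans (sym (R.+-identityʳ _)) (trans (cong (_ R.+_) (sym (bounded hr k d<k))) (sum k)))
    where
    sum : ∀ k → coeff p k R.+ coeff r k ≡ 0#
    sum k = trans (sym (coeff-+ p r k)) (at e k)

  ∣-≋ : ∀ {p a b} → p ∣ₚ a → a ≋ b → p ∣ₚ b
  ∣-≋ {p} {a} (c , e) a≋b = c , ≋⇒≈ₚ (≋-trans (≈ₚ⇒≋ (c *ₚ p) a e) a≋b)

  ∣-refl : ∀ p → p ∣ₚ p
  ∣-refl p = oneP , ≋⇒≈ₚ (*ₚ-identityˡ p)

  ∣-*ˡ : ∀ {p a} c → p ∣ₚ a → p ∣ₚ (c *ₚ a)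
  ∣-*ˡ {p} {a} c (k , e) = c *ₚ k , ≋⇒≈ₚ (≋-trans (*ₚ-assoc c k p) (*ₚ-congˡ c (≈ₚ⇒≋ (k *ₚ p) a e)))

  ∣-*ʳ : ∀ {p a} c → p ∣ₚ a → p ∣ₚ (a *ₚ c)
  ∣-*ʳ {a = a} c p∣a = ∣-≋ (∣-*ˡ c p∣a) (*ₚ-comm c a)

  ∣-trans : ∀ {p a b} → p ∣ₚ a → a ∣ₚ b → p ∣ₚ b
  ∣-trans {a = a} {b} p∣a (c , e) = ∣-≋ (∣-*ˡ c p∣a) (≈ₚ⇒≋ (c *ₚ a) b e)

  ∣-+-cancelʳ : ∀ {p} a b → p ∣ₚ (a +ₚ b) → p ∣ₚ b → p ∣ₚ a
  ∣-+-cancelʳ {p} a b (k , e) (l , f) = k +ₚ scale (R.- 1#) l , ≋⇒≈ₚ {r = a} (≋-trans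
    (*ₚ-distribʳ p k (scale (R.- 1#) l))
    (≋-trans (+ₚ-cong (≈ₚ⇒≋ (k *ₚ p) (a +ₚ b) e) (scale-*ₚ (R.- 1#) l p)) (coeffwise {r = a} subtract)))
    where
    subtract : ∀ i → coeff ((a +ₚ b) +ₚ scale (R.- 1#) (l *ₚ p)) i ≡ coeff a i
    subtract i = begin
      coeff ((a +ₚ b) +ₚ scale (R.- 1#) (l *ₚ p)) i
        ≡⟨ coeff-+ (a +ₚ b) _ i ⟩
      coeff (a +ₚ b) i R.+ coeff (scale (R.- 1#) (l *ₚ p)) i
        ≡⟨ cong₂ R._+_ (coeff-+ a b i) (trans (coeff-scale (R.- 1#) (l *ₚ p) i)
             (cong (R.- 1# R.*_) (at (≈ₚ⇒≋ (l *ₚ p) b f) i))) ⟩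
      (coeff a i R.+ coeff b i) R.+ R.- 1# R.* coeff b i
        ≡⟨ R.+-assoc _ _ _ ⟩
      coeff a i R.+ (coeff b i R.+ R.- 1# R.* coeff b i)
        ≡⟨ cong (coeff a i R.+_) (x-1x≡0 (coeff b i)) ⟩
      coeff a i R.+ 0#
        ≡⟨ R.+-identityʳ _ ⟩
      coeff a i ∎
      where
      x-1x≡0 : ∀ c → c R.+ R.- 1# R.* c ≡ 0#
      x-1x≡0 c = trans (cong (R._+ R.- 1# R.* c) (sym (R.*-identityˡ c)))
        (trans (sym (R.distribʳ c 1# (R.- 1#))) (trans (cong (R._* c) (R.-‿inverseʳ 1#)) (R.zeroˡ c)))

  coeff₀≡0⇒T∣ : ∀ {p} → coeff p 0 ≡ 0# → Tₚ ∣ₚ p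
  coeff₀≡0⇒T∣ {[]}    _   = [] , refl
  coeff₀≡0⇒T∣ {a ∷ p} a≡0 = p , ≋⇒≈ₚ (≋-trans (*ₚ-T p) (∷-cong (sym a≡0) ≋-refl))

  T-not-unit : ¬ IsUnit Tₚ
  T-not-unit (v , e) = 0≢1 (trans (sym (R.zeroˡ _))
    (trans (sym (coeff₀-* Tₚ v)) (at (≈ₚ⇒≋ (Tₚ *ₚ v) oneP e) 0)))

  degree-0⇒unit : ∀ {p} → HasDegree p 0 → IsUnit p
  degree-0⇒unit {p} hp with inv _ (leading hp)
  ... | c , pc≡1 = c ∷ [] , ≋⇒≈ₚ {p *ₚ (c ∷ [])} (≋-trans (*ₚ-const (c ∷ []) (Bounded-0⇒const {p} (bounded hp))) (∷-cong pc≡1 ≋-refl))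

  positive-degree⇒non-unit : ∀ {p d} → HasDegree p (suc d) → ¬ IsUnit p
  positive-degree⇒non-unit {p} hp (v , e) with degree? v
  ... | inj₁ v≋[] = 0≢1 (at (≋-trans (≋-sym (*ₚ-zeroʳ p)) (≋-trans (*ₚ-congˡ p (≋-sym v≋[])) pv≋1)) 0)
    where pv≋1 = ≈ₚ⇒≋ (p *ₚ v) oneP e
  ... | inj₂ (_ , hv) = ℕₚ.1+n≢0 (degree-unique (degree-cong (≈ₚ⇒≋ (p *ₚ v) oneP e) (degree-* hp hv)) degree-1)

  factor-degrees : ∀ {p d} a b → (a *ₚ b) ≈ₚ p → HasDegree p d →
                   Σ (ℕ × ℕ) λ (i , j) → HasDegree a i × HasDegree b j × i + j ≡ d
  factor-degrees {p} a b e hp with degree? a | degree? b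
  ... | inj₁ a≋[] | _ = ⊥-elim (degree-≢[] hp (≋-trans (≋-sym (≈ₚ⇒≋ (a *ₚ b) p e)) (*ₚ-congʳ b a≋[])))
  ... | inj₂ _ | inj₁ b≋[] = ⊥-elim (degree-≢[] hp
    (≋-trans (≋-sym (≈ₚ⇒≋ (a *ₚ b) p e)) (≋-trans (*ₚ-congˡ a b≋[]) (*ₚ-zeroʳ a))))
  ... | inj₂ (i , ha) | inj₂ (j , hb) =
    (i , j) , ha , hb , degree-unique (degree-cong (≈ₚ⇒≋ (a *ₚ b) p e) (degree-* ha hb)) hp

  -- The double negation spares a search through all polynomials of bounded degree.
  ¬¬irreducible-factor : ∀ d {p} → HasDegree p (suc d) → ¬ (∀ P → Irreducible P → ¬ P ∣ₚ p)
  ¬¬irreducible-factor = <-rec _ λ d rec {p} hp none → none p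
    ( (λ z → degree-≢[] hp (≈ₚ⇒≋ p [] z))
    , positive-degree⇒non-unit hp
    , λ a b e → split d rec {p} none a b e (factor-degrees a b e hp)) (∣-refl p)
    where
    split : ∀ d → (∀ {c} → c < d → ∀ {p} → HasDegree p (suc c) → ¬ (∀ P → Irreducible P → ¬ P ∣ₚ p)) →
            ∀ {p} → (∀ P → Irreducible P → ¬ P ∣ₚ p) → ∀ a b → (a *ₚ b) ≈ₚ p →
            (Σ (ℕ × ℕ) λ (i , j) → HasDegree a i × HasDegree b j × i + j ≡ suc d) → IsUnit a ⊎ IsUnit b
    split d rec none a b e ((zero  , _)     , ha , _  , _) = inj₁ (degree-0⇒unit ha)
    split d rec none a b e ((suc i , zero)  , _  , hb , _) = inj₂ (degree-0⇒unit hb)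
    split d rec {p} none a b e ((suc i , suc j) , ha , _  , i+j≡d) =
      ⊥-elim (rec (subst (i <_) (ℕₚ.suc-injective i+j≡d) (ℕₚ.m<m+n i (s≤s z≤n))) ha
        λ P irr P∣a → none P irr (∣-≋ {P} (∣-*ʳ {P} {a} b P∣a) (≈ₚ⇒≋ (a *ₚ b) p e)))

  irreducible-∣T⇒coeff₀≡0 : ∀ {P} → Irreducible P → P ∣ₚ Tₚ → coeff P 0 ≡ 0#
  irreducible-∣T⇒coeff₀≡0 {P} (_ , non-unit , _) (k , e) with factor-degrees k P e degree-T
  ... | (_ , zero) , _ , hP , _ = contradiction (degree-0⇒unit hP) non-unit
  ... | (zero , suc _) , hk , _ , _ with coeff P 0 ≟ 0#
  ...   | yes P₀≡0 = P₀≡0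
  ...   | no  P₀≢0 = contradiction
    (trans (sym (coeff₀-* k P)) (at (≈ₚ⇒≋ (k *ₚ P) Tₚ e) 0)) (*-≢0 (leading hk) P₀≢0)
  irreducible-∣T⇒coeff₀≡0 _ _ | (suc i , suc j) , _ , _ , 2+i+j≡1 =
    contradiction (ℕₚ.suc-injective 2+i+j≡1) (ℕₚ.m+1+n≢0 i)

module DrinfeldOrbit (𝔽 : FiniteField) (g Δ : Poly.Pol 𝔽) where
  open FiniteField 𝔽 using (F; 0#; 1#; 0≢1; _≟_; q)
  open Poly 𝔽
  open Drinfeld g Δ
  open FiniteFieldProperties 𝔽
  open PolynomialProperties 𝔽

  r : ℕ
  r = length units

  1≤r : 1 ≤ r
  1≤r = ℕₚ.≤-pred (subst (2 ≤_) q≡1+∣units∣ 2≤q)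

  inner : Pol → Pol
  inner y = g +ₚ (Δ *ₚ (y ^ₚ (q * r)))

  -- φ_T(y) / y, with the common power y^(q−1) of its last two terms factored out.
  cofactor : Pol → Pol
  cofactor y = Tₚ +ₚ ((y ^ₚ r) *ₚ inner y)

  y^q : ∀ y → y ^ₚ q ≋ y *ₚ (y ^ₚ r)
  y^q y = subst (λ n → y ^ₚ n ≋ y *ₚ (y ^ₚ r)) (sym q≡1+∣units∣) ≋-refl

  y^q² : ∀ y → y ^ₚ (q * q) ≋ (y *ₚ (y ^ₚ r)) *ₚ (y ^ₚ (q * r))
  y^q² y = subst (λ n → y ^ₚ n ≋ (y *ₚ (y ^ₚ r)) *ₚ (y ^ₚ (q * r)))
    (sym (trans (cong (q *_) q≡1+∣units∣) (ℕₚ.*-suc q r)))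
    (≋-trans (^ₚ-homo-* y q (q * r)) (*ₚ-congʳ (y ^ₚ (q * r)) (y^q y)))

  φT-factor : ∀ y → φT y ≋ cofactor y *ₚ y
  φT-factor y = begin
    (Tₚ *ₚ y) +ₚ ((g *ₚ (y ^ₚ q)) +ₚ (Δ *ₚ (y ^ₚ (q * q))))
      ≈⟨ +ₚ-congˡ (Tₚ *ₚ y) (+ₚ-cong (*ₚ-congˡ g (y^q y)) (*ₚ-congˡ Δ (≋-trans (y^q² y) (*ₚ-comm u w)))) ⟩
    (Tₚ *ₚ y) +ₚ ((g *ₚ u) +ₚ (Δ *ₚ (w *ₚ u)))
      ≈⟨ +ₚ-congˡ (Tₚ *ₚ y) (+ₚ-congˡ (g *ₚ u) (≋-sym (*ₚ-assoc Δ w u))) ⟩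
    (Tₚ *ₚ y) +ₚ ((g *ₚ u) +ₚ ((Δ *ₚ w) *ₚ u))
      ≈⟨ +ₚ-congˡ (Tₚ *ₚ y) (≋-sym (*ₚ-distribʳ u g (Δ *ₚ w))) ⟩
    (Tₚ *ₚ y) +ₚ (inner y *ₚ u)
      ≈⟨ +ₚ-congˡ (Tₚ *ₚ y) (≋-trans (*ₚ-comm (inner y) u) (*ₚ-assoc y (y ^ₚ r) (inner y))) ⟩
    (Tₚ *ₚ y) +ₚ (y *ₚ ((y ^ₚ r) *ₚ inner y))
      ≈⟨ +ₚ-congˡ (Tₚ *ₚ y) (*ₚ-comm y _) ⟩
    (Tₚ *ₚ y) +ₚ (((y ^ₚ r) *ₚ inner y) *ₚ y)
      ≈⟨ ≋-sym (*ₚ-distribʳ y Tₚ ((y ^ₚ r) *ₚ inner y)) ⟩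
    cofactor y *ₚ y ∎
    where
    open ≋-Reasoning
    u = y *ₚ (y ^ₚ r)
    w = y ^ₚ (q * r)

  degree-cofactor : ∀ {y d h} → HasDegree y d → HasDegree (inner y) h → 1 < r * d + h →
                    HasDegree (cofactor y) (r * d + h)
  degree-cofactor hy hh 1< = degree-+ʳ (bounded degree-T) (degree-* (degree-^ r hy) hh) 1<

  degree-inner-term : ∀ {y D d} → HasDegree Δ D → HasDegree y d →
                      HasDegree (Δ *ₚ (y ^ₚ (q * r))) (D + q * r * d)
  degree-inner-term hΔ hy = degree-* hΔ (degree-^ (q * r) hy)

  φTⁿ-φT : ∀ i y → φTⁿ i (φT y) ≡ φT (φTⁿ i y)
  φTⁿ-φT zero    y = refl
  φTⁿ-φT (suc i) y = cong φT (φTⁿ-φT i y)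

  φ-shift : ∀ i b y → φ (replicate i 0# ++ b) y ≋ φ b (φTⁿ i y)
  φ-shift zero    b y = ≋-refl
  φ-shift (suc i) b y = ≋-trans (+ₚ-cong (scale-0 y) ≋-refl)
    (subst (λ z → φ (replicate i 0# ++ b) (φT y) ≋ φ b z) (φTⁿ-φT i y) (φ-shift i b (φT y)))

  coeff-shift : ∀ i b k → coeff (replicate i 0# ++ b) (i + k) ≡ coeff b k
  coeff-shift zero    b k = refl
  coeff-shift (suc i) b k = coeff-shift i b k

  iterate-torsion : ∀ {x} i b k → coeff b k ≢ 0# → φ b (𝔄 x i) ≋ [] → IsTorsion x
  iterate-torsion {x} i b k bk≢0 e = replicate i 0# ++ b ,
    (λ z → bk≢0 (trans (sym (coeff-shift i b k)) (at (≈ₚ⇒≋ (replicate i 0# ++ b) [] z) (i + k)))) ,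
    ≋⇒≈ₚ (≋-trans (φ-shift i b x) e)

  -- If φ_T(y) = c y with c a constant then y is killed by T − c.
  constant-cofactor⇒torsion : ∀ {x} i → Bounded (cofactor (𝔄 x i)) 0 → IsTorsion x
  constant-cofactor⇒torsion {x} i bC = iterate-torsion i (R.- c ∷ 1# ∷ []) 1 (λ 1≡0 → 0≢1 (sym 1≡0))
    (coeffwise λ k → begin
      coeff (scale (R.- c) y +ₚ (scale 1# (φT y) +ₚ [])) k
        ≡⟨ coeff-+ (scale (R.- c) y) _ k ⟩
      coeff (scale (R.- c) y) k R.+ coeff (scale 1# (φT y) +ₚ []) k
        ≡⟨ cong₂ R._+_ (coeff-scale (R.- c) y k) (at φTy≋cy k) ⟩
      R.- c R.* coeff y k R.+ coeff (scale c y) k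
        ≡⟨ cong (R.- c R.* coeff y k R.+_) (coeff-scale c y k) ⟩
      R.- c R.* coeff y k R.+ c R.* coeff y k
        ≡⟨ sym (R.distribʳ _ _ _) ⟩
      (R.- c R.+ c) R.* coeff y k
        ≡⟨ cong (R._* coeff y k) (R.-‿inverseˡ c) ⟩
      0# R.* coeff y k
        ≡⟨ R.zeroˡ _ ⟩
      0# ∎)
    where
    open ≡-Reasoning
    y = 𝔄 x i
    c = coeff (cofactor y) 0
    φTy≋cy : scale 1# (φT y) +ₚ [] ≋ scale c y
    φTy≋cy = ≋-trans (+ₚ-comm (scale 1# (φT y)) []) (≋-trans (scale-1 (φT y))
      (≋-trans (φT-factor y) (*ₚ-const y (Bounded-0⇒const {cofactor y} bC))))

  ∣-φTⁿ : ∀ {P} x i o → P ∣ₚ 𝔄 x i → P ∣ₚ 𝔄 x (o + i)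
  ∣-φTⁿ     x i zero    P∣ = P∣
  ∣-φTⁿ {P} x i (suc o) P∣ =
    ∣-≋ {P} (∣-*ˡ {P} {y} (cofactor y) (∣-φTⁿ {P} x i o P∣)) (≋-sym (φT-factor y))
    where y = 𝔄 x (o + i)

  ∣-cofactor⇒∣T : ∀ {P} y → P ∣ₚ cofactor y → P ∣ₚ y → P ∣ₚ Tₚ
  ∣-cofactor⇒∣T {P} y P∣C P∣y = ∣-+-cancelʳ {P} Tₚ ((y ^ₚ r) *ₚ inner y) P∣C
    (∣-*ʳ {P} {y ^ₚ r} (inner y) (∣-power r 1≤r))
    where
    ∣-power : ∀ n → 1 ≤ n → P ∣ₚ (y ^ₚ n)
    ∣-power (suc n) _ = ∣-*ʳ {P} {y} (y ^ₚ n) P∣y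

  fermat-multiple : ∀ {a} n → a ≢ 0# → a ^ᶠ (n * r) ≡ 1#
  fermat-multiple zero    _   = refl
  fermat-multiple {a} (suc n) a≢0 = trans (^ᶠ-homo-* a r (n * r))
    (trans (cong₂ R._*_ (fermat a≢0) (fermat-multiple n a≢0)) (R.*-identityˡ 1#))

  coeff₀-cofactor : ∀ y → coeff (cofactor y) 0 ≡ (coeff y 0 ^ᶠ r) R.* coeff (inner y) 0
  coeff₀-cofactor y = trans (coeff-+ Tₚ ((y ^ₚ r) *ₚ inner y) 0) (trans (R.+-identityˡ _)
    (trans (coeff₀-* (y ^ₚ r) (inner y)) (cong (R._* coeff (inner y) 0) (coeff₀-^ y r))))

  coeff₀-cofactor-unit : ∀ y → coeff y 0 ≢ 0# → coeff (cofactor y) 0 ≡ coeff g 0 R.+ coeff Δ 0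
  coeff₀-cofactor-unit y y₀≢0 = begin
    coeff (cofactor y) 0
      ≡⟨ coeff₀-cofactor y ⟩
    (coeff y 0 ^ᶠ r) R.* coeff (inner y) 0
      ≡⟨ cong₂ R._*_ (fermat y₀≢0) (coeff-+ g _ 0) ⟩
    1# R.* (coeff g 0 R.+ coeff (Δ *ₚ (y ^ₚ (q * r))) 0)
      ≡⟨ R.*-identityˡ _ ⟩
    coeff g 0 R.+ coeff (Δ *ₚ (y ^ₚ (q * r))) 0
      ≡⟨ cong (coeff g 0 R.+_) (trans (coeff₀-* Δ (y ^ₚ (q * r)))
           (cong (coeff Δ 0 R.*_) (trans (coeff₀-^ y (q * r)) (fermat-multiple q y₀≢0)))) ⟩
    coeff g 0 R.+ coeff Δ 0 R.* 1#
      ≡⟨ cong (coeff g 0 R.+_) (R.*-identityʳ _) ⟩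
    coeff g 0 R.+ coeff Δ 0 ∎
    where open ≡-Reasoning

  0^ᶠ : ∀ {a} n → 1 ≤ n → a ≡ 0# → a ^ᶠ n ≡ 0#
  0^ᶠ (suc n) _ refl = R.zeroˡ _

  coeff₀-cofactor-0 : ∀ y → coeff y 0 ≡ 0# → coeff (cofactor y) 0 ≡ 0#
  coeff₀-cofactor-0 y y₀≡0 = trans (coeff₀-cofactor y)
    (≡0⇒*≡0ˡ (0^ᶠ r 1≤r y₀≡0))

  coeff₁-*-0 : ∀ p s → coeff p 0 ≡ 0# → coeff p 1 R.* coeff s 0 ≡ 0# → coeff (p *ₚ s) 1 ≡ 0#
  coeff₁-*-0 p s p₀≡0 p₁s₀≡0 = trans (coeff₁-* p s) (trans
    (cong₂ R._+_ (≡0⇒*≡0ˡ p₀≡0) p₁s₀≡0) (R.+-identityˡ 0#))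

  coeff₁-cofactor : ∀ y → coeff y 0 ≡ 0# → coeff y 1 ≡ 0# → coeff (cofactor y) 1 ≡ 1#
  coeff₁-cofactor y y₀≡0 y₁≡0 = trans (coeff-+ Tₚ ((y ^ₚ r) *ₚ inner y) 1) (trans
    (cong (1# R.+_) (coeff₁-*-0 (y ^ₚ r) (inner y)
      (trans (coeff₀-^ y r) (0^ᶠ r 1≤r y₀≡0))
      (≡0⇒*≡0ˡ (power₁ r 1≤r))))
    (R.+-identityʳ 1#))
    where
    power₁ : ∀ n → 1 ≤ n → coeff (y ^ₚ n) 1 ≡ 0#
    power₁ (suc n) _ = coeff₁-*-0 y (y ^ₚ n) y₀≡0 (≡0⇒*≡0ˡ y₁≡0)

  module _ (Δ≢0 : ¬ IsZero Δ) (coprime : Coprime (φT oneP) (Tₚ *ₚ Δ))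
           (x : Pol) (non-torsion : ¬ IsTorsion x) where

    cofactor-degree : ∀ i → ∃ λ e → HasDegree (cofactor (𝔄 x i)) (suc e)
    cofactor-degree i with degree? (cofactor (𝔄 x i))
    ... | inj₁ C≋[]          = contradiction (constant-cofactor⇒torsion i λ k _ → at C≋[] k) non-torsion
    ... | inj₂ (zero  , hC) = contradiction (constant-cofactor⇒torsion i (bounded hC)) non-torsion
    ... | inj₂ (suc e , hC) = e , hC

    iterate-degree : ∀ i → ∃ λ d → HasDegree (𝔄 x i) d × i ≤ d
    iterate-degree zero with degree? x
    ... | inj₂ (d , hx) = d , hx , z≤n
    ... | inj₁ x≋[] = contradiction
      (iterate-torsion 0 (1# ∷ []) 0 (λ 1≡0 → 0≢1 (sym 1≡0))
        (≋-trans (+ₚ-comm (scale 1# x) []) (≋-trans (scale-1 x) x≋[]))) non-torsion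
    iterate-degree (suc i) with cofactor-degree i | iterate-degree i
    ... | e , hC | d , hy , i≤d =
      suc e + d , degree-cong (≋-sym (φT-factor (𝔄 x i))) (degree-* hC hy) ,
      s≤s (ℕₚ.≤-trans i≤d (ℕₚ.m≤n+m d e))

    -- If the inner sum vanished at 𝔄ⱼ₊₁, then deg g ≥ 2 deg 𝔄ⱼ₊₁, so that g would dominate
    -- the inner sum at 𝔄ⱼ and force deg 𝔄ⱼ₊₁ ≥ deg g.
    inner-nonzero : ∀ j → 1 ≤ j → ¬ inner (𝔄 x (suc j)) ≋ []
    inner-nonzero j 1≤j inner≋[] with degree? Δ | cofactor-degree j | iterate-degree j
    ... | inj₁ Δ≋[] | _ | _ = Δ≢0 (≋⇒≈ₚ Δ≋[])
    ... | inj₂ (D , hΔ) | e , hC | d , hy , j≤d = ℕₚ.<⇒≱ d′<G (begin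
        G            ≤⟨ ℕₚ.m≤n+m G (r * d) ⟩
        r * d + G    ≡⟨ degree-unique (degree-cofactor hy inner-degree 1<rd+G) hC ⟩
        suc e        ≤⟨ ℕₚ.m≤m+n (suc e) d ⟩
        d′           ∎)
      where
      open ℕₚ.≤-Reasoning
      d′ = suc e + d
      G = D + q * r * d′
      hy′ : HasDegree (𝔄 x (suc j)) d′
      hy′ = degree-cong (≋-sym (φT-factor (𝔄 x j))) (degree-* hC hy)
      2≤qr : 2 ≤ q * r
      2≤qr = ℕₚ.*-mono-≤ 2≤q 1≤r
      d′<G : d′ < G
      d′<G = begin-strict
        d′            <⟨ ℕₚ.m<m+n d′ (s≤s z≤n) ⟩
        d′ + d′       ≡⟨ cong (d′ +_) (sym (ℕₚ.+-identityʳ d′)) ⟩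
        2 * d′        ≤⟨ ℕₚ.*-monoˡ-≤ d′ 2≤qr ⟩
        q * r * d′    ≤⟨ ℕₚ.m≤n+m _ D ⟩
        G             ∎
      g-degree : HasDegree g G
      g-degree = degree-cancelling inner≋[] (degree-inner-term hΔ hy′)
      inner-degree : HasDegree (inner (𝔄 x j)) G
      inner-degree = degree-+ˡ g-degree (bounded (degree-inner-term hΔ hy))
        (ℕₚ.+-monoʳ-< D (ℕₚ.*-monoʳ-< (q * r) {{>-nonZero (ℕₚ.<⇒≤ 2≤qr)}} (ℕₚ.m<n+m d (s≤s z≤n))))
      1<rd+G : 1 < r * d + G
      1<rd+G = begin-strict
        1             <⟨ s≤s (ℕₚ.≤-trans 1≤j (ℕₚ.≤-trans j≤d (ℕₚ.m≤n+m d e))) ⟩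
        d′            ≤⟨ ℕₚ.<⇒≤ d′<G ⟩
        G             ≤⟨ ℕₚ.m≤n+m G (r * d) ⟩
        r * d + G     ∎

    cofactor-degree≥2 : ∀ j → 1 ≤ j → ∃ λ e → HasDegree (cofactor (𝔄 x (suc j))) (suc (suc e))
    cofactor-degree≥2 j 1≤j with degree? (inner (𝔄 x (suc j))) | iterate-degree (suc j) | cofactor-degree (suc j)
    ... | inj₁ inner≋[] | _              | _           = contradiction inner≋[] (inner-nonzero j 1≤j)
    ... | inj₂ _        | _              | suc e , hC  = e , hC
    ... | inj₂ (h , hh) | d , hy , 1+j≤d | zero , hC =
      contradiction (degree-unique (degree-cofactor hy hh 1<rd+h) hC) (ℕₚ.>⇒≢ 1<rd+h)
      where
      1<rd+h : 1 < r * d + h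
      1<rd+h = ℕₚ.≤-trans (ℕₚ.*-mono-≤ 1≤r (ℕₚ.≤-trans (s≤s 1≤j) 1+j≤d)) (ℕₚ.m≤m+n (r * d) h)

    g₀+Δ₀≢0 : coeff g 0 R.+ coeff Δ 0 ≢ 0#
    g₀+Δ₀≢0 sum≡0 = T-not-unit (coprime Tₚ
      (coeff₀≡0⇒T∣ {φT oneP} (trans (at (φT-factor oneP) 0) (trans (coeff₀-* (cofactor oneP) oneP)
        (trans (cong (R._* 1#) (trans (coeff₀-cofactor-unit oneP (λ 1≡0 → 0≢1 (sym 1≡0))) sum≡0)) (R.zeroˡ 1#)))))
      (Δ , ≋⇒≈ₚ (*ₚ-comm Δ Tₚ)))

    T∣iterate⇒T²∣ : ∀ j → coeff (𝔄 x (suc j)) 0 ≡ 0# → coeff (𝔄 x (suc j)) 1 ≡ 0#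
    T∣iterate⇒T²∣ j y₀≡0 with coeff (𝔄 x j) 0 ≟ 0#
    ... | yes z₀≡0 = trans (at (φT-factor (𝔄 x j)) 1)
      (coeff₁-*-0 (cofactor (𝔄 x j)) (𝔄 x j) (coeff₀-cofactor-0 (𝔄 x j) z₀≡0)
        (≡0⇒*≡0ʳ {coeff (cofactor (𝔄 x j)) 1} z₀≡0))
    ... | no z₀≢0 = contradiction
      (trans (sym (coeff₀-* (cofactor (𝔄 x j)) (𝔄 x j))) (trans (sym (at (φT-factor (𝔄 x j)) 0)) y₀≡0))
      (*-≢0 (λ C₀≡0 → g₀+Δ₀≢0 (trans (sym (coeff₀-cofactor-unit (𝔄 x j) z₀≢0)) C₀≡0)) z₀≢0)

    prime-to-T-part : ∀ j → 1 ≤ j → ∃ λ c →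
      c ∣ₚ cofactor (𝔄 x (suc j)) × coeff c 0 ≢ 0# × ∃ λ e → HasDegree c (suc e)
    prime-to-T-part j 1≤j with coeff (𝔄 x (suc j)) 0 ≟ 0# | cofactor-degree≥2 j 1≤j
    ... | no y₀≢0  | e , hC = cofactor y , ∣-refl (cofactor y) ,
      (λ C₀≡0 → g₀+Δ₀≢0 (trans (sym (coeff₀-cofactor-unit y y₀≢0)) C₀≡0)) , suc e , hC
      where y = 𝔄 x (suc j)
    ... | yes y₀≡0 | e , hC
      with cofactor (𝔄 x (suc j)) | hC | coeff₀-cofactor-0 (𝔄 x (suc j)) y₀≡0
         | coeff₁-cofactor (𝔄 x (suc j)) y₀≡0 (T∣iterate⇒T²∣ j y₀≡0)
    ...   | []    | hC′ | _    | _    = contradiction refl (leading hC′)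
    ...   | a ∷ c | hC′ | a≡0 | c₀≡1 =
      c , (Tₚ , ≋⇒≈ₚ (≋-trans (*ₚ-comm Tₚ c) (≋-trans (*ₚ-T c) (∷-cong (sym a≡0) ≋-refl)))) ,
      (λ c₀≡0 → 0≢1 (trans (sym c₀≡0) c₀≡1)) , e ,
      hasDegree (leading hC′) (λ k e<k → bounded hC′ (suc k) (s≤s e<k))

    ¬¬primitive-divisor : ∀ j → 1 ≤ j → ¬ ¬ HasPrimitiveDivisor x (suc (suc j))
    ¬¬primitive-divisor j 1≤j none with prime-to-T-part j 1≤j
    ... | c , c∣C , c₀≢0 , e , hc = ¬¬irreducible-factor e hc λ P irr P∣c →
      let P∣C = ∣-trans {P} {c} {cofactor y} P∣c c∣C in none
        ( P , irr
        , ∣-≋ {P} (∣-*ʳ {P} {cofactor y} y P∣C) (≋-sym (φT-factor y))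
        , λ i i<n P∣𝔄ᵢ → c₀≢0 (coeff₀-multiple P∣c (irreducible-∣T⇒coeff₀≡0 irr
            (∣-cofactor⇒∣T {P} y P∣C (subst (λ n → P ∣ₚ 𝔄 x n) (ℕₚ.m∸n+n≡m (ℕₚ.≤-pred i<n))
              (∣-φTⁿ {P} x i (suc j ∸ i) P∣𝔄ᵢ))))))
      where
      y = 𝔄 x (suc j)
      coeff₀-multiple : ∀ {P} → P ∣ₚ c → coeff P 0 ≡ 0# → coeff c 0 ≡ 0#
      coeff₀-multiple {P} (k , e′) P₀≡0 = trans (sym (at (≈ₚ⇒≋ (k *ₚ P) c e′) 0))
        (trans (coeff₀-* k P) (≡0⇒*≡0ʳ P₀≡0))

    zsigmondy≤2 : ∀ n → InZsigmondy x n → n ≤ 2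
    zsigmondy≤2 0 _ = z≤n
    zsigmondy≤2 1 _ = s≤s z≤n
    zsigmondy≤2 2 _ = s≤s (s≤s z≤n)
    zsigmondy≤2 (suc (suc (suc n))) (_ , none) = contradiction none (¬¬primitive-divisor (suc n) (s≤s z≤n))

theorem1p1 : (𝔽 : FiniteField) → let open FiniteField 𝔽 using (q) in let open Poly 𝔽 in
    (g Δ : Pol) → ¬ IsZero Δ →
    let open Drinfeld g Δ in
    -- N = lcm of the degrees of the irreducible divisors of Δ
    (N : ℕ) →
    (∀ P → Irreducible P → P ∣ₚ Δ → deg P ∣ N) →
    (∀ M → (∀ P → Irreducible P → P ∣ₚ Δ → deg P ∣ M) → N ∣ M) →
    -- ps = the finite places dividing TΔ (monic irreducible divisors); |S| = length ps + 1
    (ps : List Pol) → Unique ps →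
    (∀ P → P ∈ ps → Monic P × Irreducible P) →
    (∀ P → Monic P → Irreducible P → P ∣ₚ (Tₚ *ₚ Δ) → P ∈ ps) →
    (∀ P → P ∈ ps → P ∣ₚ (Tₚ *ₚ Δ)) →
    -- φ_T(1) = T + g + Δ coprime to TΔ
    Coprime (φT oneP) (Tₚ *ₚ Δ) →
    (x : Pol) → ¬ IsTorsion x →
    (n : ℕ) → InZsigmondy x n →
    -- n ≤ A + (1/2) log_q B   ⇔   q^(2 (n ∸ A)) ≤ B
    q ^ (2 * (n ∸ (6 * (q ^ (2 * N) ∸ 1) * N * (length ps + 1) + 4)))
      ≤ 2 + 2 * deg g + 2 * deg Δ
theorem1p1 𝔽 g Δ Δ≢0 N _ _ ps _ _ _ _ coprime x non-torsion n n∈Z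
  rewrite ℕₚ.m≤n⇒m∸n≡0 {n} {6 * (FiniteField.q 𝔽 ^ (2 * N) ∸ 1) * N * (length ps + 1) + 4}
            (ℕₚ.≤-trans (DrinfeldOrbit.zsigmondy≤2 𝔽 g Δ Δ≢0 coprime x non-torsion n n∈Z)
              (ℕₚ.≤-trans (s≤s (s≤s z≤n)) (ℕₚ.m≤n+m 4 _)))
  = s≤s z≤n
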